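{- Define polynomials as follows. Let $$K_1(y,x_1,x_2,x_3)=\prod_{\varepsilon_1,\varepsilon_2,\varepsilon_3\in\{1,-1\}}\bigl(-y+\varepsilon_1\sqrt{x_1}+2\varepsilon_2\sqrt{x_2}+4\varepsilon_3\sqrt{x_3}\bigr),$$ which, after expansion, contains only even powers of $\sqrt{x_1},\sqrt{x_2},\sqrt{x_3}$ and hence is a polynomial in $y,x_1,x_2,x_3$ with integer coefficients of degree at most $8$ in $y$. Let $K_2(y,x_1,x_2,x_3,p,r)$ be the integer polynomial satisfying $K_2(y,x_1,x_2,x_3,p,r)=p^8\,K_1\!\left(y-\tfrac{r}{p},x_1,x_2,x_3\right)$ whenever $p\neq 0$ (obtained by writing $K_1(y-z,x_1,x_2,x_3)=\sum_{\alpha\le 8}c_\alpha(y,x_1,x_2,x_3)z^\alpha$ and setting $K_2=\sum_{\alpha\le 8}c_\alpha(y,x_1,x_2,x_3)\,p^{8-\alpha}r^{\alpha}$), and let $$K(y,x_1,x_2,x_3,p,r,n,v)=K_2(y-nv,x_1,x_2,x_3,p,r).$$ Let $x_1,x_2,x_3,p,r,n\in\mathbb{N}$ and $v\in\mathbb{Z}$ with $x_1$ odd, $x_2$ odd, $p>0$, and $n>\sqrt{x_1}+2\sqrt{x_2}+4\sqrt{x_3}+r$. Then there exists $y\in\mathbb{N}$ with $K(y,x_1,x_2,x_3,p,r,n,v)=0$ if and only if $x_1$, $x_2$ and $x_3$ are all squares of natural numbers, $p\mid r$, and $v\ge 0$. -}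

module Defs where

open import Data.Integer using (ℤ; +_; -_; _+_; _*_; _-_; 0ℤ; 1ℤ; -1ℤ)
open import Data.Nat using (ℕ)
import Data.Nat as ℕ
open import Data.Product using (_×_; _,_; proj₁; proj₂; ∃)
open import Data.List using (List; []; _∷_; foldr)
open import Relation.Binary.PropositionalEquality using (_≡_)

record Alg : Set₁ where
  field
    Carrier : Set
    add     : Carrier → Carrier → Carrier
    mul     : Carrier → Carrier → Carrier
    inj     : ℤ → Carrier

open Alg

ℤAlg : Alg
ℤAlg = record { Carrier = ℤ ; add = _+_ ; mul = _*_ ; inj = λ z → z }

-- Formal adjunction of a square root of d :  A[t]/(t² - d),
-- elements u + v t represented as (u , v).
Adj : (A : Alg) → Carrier A → Alg
Adj A d = record
  { Carrier = Carrier A × Carrier A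
  ; add = λ { (u , v) (u' , v') → add A u u' , add A v v' }
  ; mul = λ { (u , v) (u' , v') →
              add A (mul A u u') (mul A d (mul A v v')) ,
              add A (mul A u v') (mul A v u') }
  ; inj = λ z → inj A z , inj A 0ℤ
  }

root : (A : Alg) (d : Carrier A) → Carrier (Adj A d)
root A d = inj A 0ℤ , inj A 1ℤ

lift : (A : Alg) (d : Carrier A) → Carrier A → Carrier (Adj A d)
lift A d u = u , inj A 0ℤ

R1 : ℤ → Alg
R1 x₁ = Adj ℤAlg x₁

R2 : ℤ → ℤ → Alg
R2 x₁ x₂ = Adj (R1 x₁) (inj (R1 x₁) x₂)

R3 : ℤ → ℤ → ℤ → Alg
R3 x₁ x₂ x₃ = Adj (R2 x₁ x₂) (inj (R2 x₁ x₂) x₃)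

module _ (x₁ x₂ x₃ : ℤ) where
  private
    A1 = R1 x₁
    A2 = R2 x₁ x₂
    A3 = R3 x₁ x₂ x₃
    d2 = inj A1 x₂
    d3 = inj A2 x₃

  √x₁ : Carrier A3
  √x₁ = lift A2 d3 (lift A1 d2 (root ℤAlg x₁))

  √x₂ : Carrier A3
  √x₂ = lift A2 d3 (root A1 d2)

  √x₃ : Carrier A3
  √x₃ = root A2 d3

  const : Carrier A3 → ℤ
  const w = proj₁ (proj₁ (proj₁ w))

  signs : List ℤ
  signs = 1ℤ ∷ -1ℤ ∷ []

  prod± : (ℤ → ℤ → ℤ → Carrier A3) → Carrier A3
  prod± f = foldr (λ e₁ acc₁ → mul A3
              (foldr (λ e₂ acc₂ → mul A3
                 (foldr (λ e₃ acc₃ → mul A3 (f e₁ e₂ e₃) acc₃) (inj A3 1ℤ) signs)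
                 acc₂) (inj A3 1ℤ) signs)
              acc₁) (inj A3 1ℤ) signs

  S : ℤ → ℤ → ℤ → Carrier A3
  S e₁ e₂ e₃ = add A3 (mul A3 (inj A3 e₁) √x₁)
               (add A3 (mul A3 (inj A3 (+ 2 * e₂)) √x₂)
                       (mul A3 (inj A3 (+ 4 * e₃)) √x₃))

-- K₁(y,x₁,x₂,x₃) = ∏ (-y + ε₁√x₁ + 2ε₂√x₂ + 4ε₃√x₃), the ℤ-coordinate of the
-- formal expansion (the other coordinates vanish, as in the paper).
K₁ : ℤ → ℤ → ℤ → ℤ → ℤ
K₁ y x₁ x₂ x₃ = const x₁ x₂ x₃ (prod± x₁ x₂ x₃ λ e₁ e₂ e₃ →
  add (R3 x₁ x₂ x₃) (inj (R3 x₁ x₂ x₃) (- y)) (S x₁ x₂ x₃ e₁ e₂ e₃))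

-- K₂(y,x₁,x₂,x₃,p,r) = Σ_α c_α p^(8-α) r^α  where K₁(y-z,…) = Σ c_α z^α.
-- Equivalently (identity of polynomials): the homogenisation in (p , r) of
-- ∏ (-(y - z) + S_ε), namely  ∏ (p·(-y + S_ε) + r).
K₂ : ℤ → ℤ → ℤ → ℤ → ℤ → ℤ → ℤ
K₂ y x₁ x₂ x₃ p r = const x₁ x₂ x₃ (prod± x₁ x₂ x₃ λ e₁ e₂ e₃ →
  add A (mul A (inj A p) (add A (inj A (- y)) (S x₁ x₂ x₃ e₁ e₂ e₃))) (inj A r))
  where A = R3 x₁ x₂ x₃

K : ℤ → ℤ → ℤ → ℤ → ℤ → ℤ → ℤ → ℤ → ℤ
K y x₁ x₂ x₃ p r n v = K₂ (y - n * v) x₁ x₂ x₃ p r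

-- "n > √x₁ + 2√x₂ + 4√x₃ + r" for natural numbers, stated without reals:
-- there are rational upper bounds a/d ≥ √x₁, b/d ≥ √x₂, c/d ≥ √x₃ (d > 0)
-- with a/d + 2 b/d + 4 c/d + r < n.  (Exactly equivalent to the real
-- inequality, since the inequality is strict.)
SqrtBound : ℕ → ℕ → ℕ → ℕ → ℕ → Set
SqrtBound x₁ x₂ x₃ r n =
  ∃ λ a → ∃ λ b → ∃ λ c → ∃ λ d →
    (0 ℕ.< d) ×
    (x₁ ℕ.* (d ℕ.* d) ℕ.≤ a ℕ.* a) ×
    (x₂ ℕ.* (d ℕ.* d) ℕ.≤ b ℕ.* b) ×
    (x₃ ℕ.* (d ℕ.* d) ℕ.≤ c ℕ.* c) ×
    (a ℕ.+ 2 ℕ.* b ℕ.+ 4 ℕ.* c ℕ.+ r ℕ.* d ℕ.< n ℕ.* d)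

Odd : ℕ → Set
Odd x = ∃ λ k → x ≡ ℕ.suc (2 ℕ.* k)

{-# OPTIONS --safe #-}
module Submission where

-- Put w = r - pY with Y = y - nv, α = p²x₁, β = 4p²x₂, γ = 16p²x₃.  Multiplying
-- out the factors w ± √α ± √β ± √γ one square root at a time gives K = E² - α F²,
-- where E + √α F = (D + 2w√α)² - β (2(w + √α))² and
-- (D + 2w√α) + 2√β (w + √α) = (w + √α + √β)² - γ.  When K = 0 the three
-- differences of squares yield, one after the other, integer values of √x₁, √x₂
-- and √x₃ (with signs) and w = -p(√x₁ + 2√x₂ + 4√x₃), so p ∣ r; the bound on n
-- gives |Y| < n and hence v ≥ 0.  Parity of x₁ and x₂ excludes the degenerate
-- cases w = 0, α = β, α = γ, β = γ, the only ones in which a coefficient of a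
-- square root could vanish.

open import Defs
open import Data.Nat using (ℕ; _<_; _*_)
open import Data.Nat.Divisibility using (_∣_; divides)
open import Data.Integer using (ℤ; +_; 0ℤ) renaming (_≤_ to _≤ℤ_)
open import Data.Product using (_×_; ∃)
open import Function.Bundles using (_⇔_)
open import Relation.Binary.PropositionalEquality using (_≡_)

open import Data.Fin using (#_)
open import Data.Integer using (-[1+_]; 1ℤ; -1ℤ; -_; ∣_∣)
import Data.Integer as ℤ
import Data.Integer.Properties as ℤ
open import Data.Integer.Solver using (module +-*-Solver)
open import Data.Nat using (suc; NonZero)
import Data.Nat as ℕ
import Data.Nat.Properties as ℕ
open import Data.Nat.Coprimality using (Coprime; coprime-divisor; coprime-/gcd)
open import Data.Nat.DivMod using (_/_; m/n*n≡m)
import Data.Nat.Divisibility as ℕ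
open import Data.Nat.GCD using (gcd; gcd[m,n]∣m; gcd[m,n]∣n; gcd[m,n]≢0)
import Data.Nat.Solver as ℕSolver
open import Data.Product using (_,_; proj₁)
open import Data.Sum using (inj₁; [_,_]′)
open import Data.Vec using (Vec; _∷_; [])
open import Function using (id)
open import Function.Bundles using (mk⇔)
open import Relation.Binary.PropositionalEquality
  using (_≢_; refl; sym; trans; cong; cong₂; subst; subst₂; module ≡-Reasoning)
open import Relation.Nullary using (contradiction; yes; no)
open Alg
open +-*-Solver
module ℕS = ℕSolver.+-*-Solver

-- Expansion of the eight conjugate factors.

-- Formulas are written over an arbitrary Alg, so that the same definition yields
-- both the integer expression and its syntax for the ring solver.
PolynomialAlg : ℕ → Alg
PolynomialAlg n = record { Carrier = Polynomial n ; add = _:+_ ; mul = _:*_ ; inj = con }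

module Forms (A : Alg) where
  private
    infixl 6 _⊕_ _⊖_
    infixl 7 _⊗_
    _⊕_ _⊗_ _⊖_ : Carrier A → Carrier A → Carrier A
    _⊕_ = add A
    _⊗_ = mul A
    -- `Alg` has no negation, so a difference is a sum with a multiple of `-1ℤ`. The solver
    -- identities below repeat this shape so as to match definitionally.
    x ⊖ y = x ⊕ inj A -1ℤ ⊗ y
    two four 0# : Carrier A
    two  = inj A (+ 2)
    four = inj A (+ 4)
    0#   = inj A 0ℤ

  D E F N : Carrier A → Carrier A → Carrier A → Carrier A → Carrier A
  D w α β γ = w ⊗ w ⊕ α ⊕ β ⊖ γ
  E w α β γ = D w α β γ ⊗ D w α β γ ⊕ four ⊗ (w ⊗ w ⊗ α) ⊖ four ⊗ β ⊗ (w ⊗ w ⊕ α)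
  F w α β γ = four ⊗ w ⊗ (D w α β γ ⊖ two ⊗ β)
  N w α β γ = E w α β γ ⊗ E w α β γ ⊖ α ⊗ (F w α β γ ⊗ F w α β γ)

  module Tower (x₁ x₂ x₃ : Carrier A) where
    T₁ T₂ T₃ : Alg
    T₁ = Adj A x₁
    T₂ = Adj T₁ (x₂ , 0#)
    T₃ = Adj T₂ ((x₃ , 0#) , (0# , 0#))

    pair : Carrier T₃ → Carrier T₃ → Carrier T₃
    pair s t = mul T₃ s (mul T₃ t (inj T₃ 1ℤ))

    up : Carrier T₁ → Carrier T₃
    up t = lift T₂ ((x₃ , 0#) , (0# , 0#)) (lift T₁ (x₂ , 0#) t)

    constant : Carrier A → Carrier T₃
    constant t = up (t , 0#)

    -- w + a√x₁ + b√x₂ + c√x₃, then its product over c ↦ ±c, and over b ↦ ±b, c ↦ ±c.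
    linear conj₃ conj₂₃ : (w a b c : Carrier A) → Carrier T₃
    linear w a b c = ((w , a) , (b , 0#)) , ((c , 0#) , (0# , 0#))
    conj₃ w a b c = lift T₂ ((x₃ , 0#) , (0# , 0#))
      ( (D w (a ⊗ a ⊗ x₁) (b ⊗ b ⊗ x₂) (c ⊗ c ⊗ x₃) , two ⊗ w ⊗ a)
      , (two ⊗ w ⊗ b , two ⊗ a ⊗ b) )
    conj₂₃ w a b c = up
      ( E w (a ⊗ a ⊗ x₁) (b ⊗ b ⊗ x₂) (c ⊗ c ⊗ x₃)
      , a ⊗ F w (a ⊗ a ⊗ x₁) (b ⊗ b ⊗ x₂) (c ⊗ c ⊗ x₃) )

module Z = Forms ℤAlg
module P n = Forms (PolynomialAlg n)

-- The coefficients stay in the form `q * q * x` with `q` equal to `p`, `2p`, `4p`: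
-- `const-pair-conj₂₃` produces this form, and `signed-root` reads `q` off it.
norm : (p x₁ x₂ x₃ w : ℤ) → ℤ
norm p x₁ x₂ x₃ w =
  Z.N w (p ℤ.* p ℤ.* x₁) (+ 2 ℤ.* p ℤ.* (+ 2 ℤ.* p) ℤ.* x₂) (+ 4 ℤ.* p ℤ.* (+ 4 ℤ.* p) ℤ.* x₃)

Tuple : Set → Set
Tuple X = ((X × X) × (X × X)) × ((X × X) × (X × X))

eval evalNormal : ∀ {n} → Tuple (Polynomial n) → Vec ℤ n → Tuple ℤ
eval (((a , b) , (c , d)) , ((e , f) , (g , h))) ρ =
  ((⟦ a ⟧ ρ , ⟦ b ⟧ ρ) , (⟦ c ⟧ ρ , ⟦ d ⟧ ρ)) , ((⟦ e ⟧ ρ , ⟦ f ⟧ ρ) , (⟦ g ⟧ ρ , ⟦ h ⟧ ρ))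
evalNormal (((a , b) , (c , d)) , ((e , f) , (g , h))) ρ =
  ((⟦ a ⟧↓ ρ , ⟦ b ⟧↓ ρ) , (⟦ c ⟧↓ ρ , ⟦ d ⟧↓ ρ)) , ((⟦ e ⟧↓ ρ , ⟦ f ⟧↓ ρ) , (⟦ g ⟧↓ ρ , ⟦ h ⟧↓ ρ))

correctTuple : ∀ {n} (t : Tuple (Polynomial n)) ρ → evalNormal t ρ ≡ eval t ρ
correctTuple (((a , b) , (c , d)) , ((e , f) , (g , h))) ρ =
  cong₂ _,_ (cong₂ _,_ (cong₂ _,_ (correct a ρ) (correct b ρ)) (cong₂ _,_ (correct c ρ) (correct d ρ)))
            (cong₂ _,_ (cong₂ _,_ (correct e ρ) (correct f ρ)) (cong₂ _,_ (correct g ρ) (correct h ρ)))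

-- Reflection in all eight coordinates at once, so that a single `refl` between normal forms proves
-- an identity in `T₃`.
proveTuple : ∀ {n} (ρ : Vec ℤ n) (s t : Tuple (Polynomial n)) →
  evalNormal s ρ ≡ evalNormal t ρ → eval s ρ ≡ eval t ρ
proveTuple ρ s t eq = trans (sym (correctTuple s ρ)) (trans eq (correctTuple t ρ))

module _ (x₁ x₂ x₃ : ℤ) where
  open Z.Tower x₁ x₂ x₃
  private
    module PT = P.Tower 7 (var (# 4)) (var (# 5)) (var (# 6))
    w′ a′ b′ c′ : Polynomial 7
    w′ = var (# 0)
    a′ = var (# 1)
    b′ = var (# 2)
    c′ = var (# 3)

  -- The product is `(w + a√x₁ + b√x₂)² - c²x₃`. The signs remain as the factors `1ℤ` and `-1ℤ`,
  -- since `factor≡linear` delivers the coefficients in that form.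
  pair-linear : ∀ w a b c → pair (linear w a b (1ℤ ℤ.* c)) (linear w a b (-1ℤ ℤ.* c)) ≡ conj₃ w a b c
  pair-linear w a b c = proveTuple (w ∷ a ∷ b ∷ c ∷ x₁ ∷ x₂ ∷ x₃ ∷ [])
    (PT.pair (PT.linear w′ a′ b′ (con 1ℤ :* c′)) (PT.linear w′ a′ b′ (con -1ℤ :* c′)))
    (PT.conj₃ w′ a′ b′ c′) refl

  -- `conj₃` is `(D + 2wa√x₁) + √x₂ · 2b(w + a√x₁)`, so changing the sign of `b` conjugates `√x₂`,
  -- and the product is again a difference of squares.
  pair-conj₃ : ∀ w a b c → pair (conj₃ w a (1ℤ ℤ.* b) c) (conj₃ w a (-1ℤ ℤ.* b) c) ≡ conj₂₃ w a b c
  pair-conj₃ w a b c = proveTuple (w ∷ a ∷ b ∷ c ∷ x₁ ∷ x₂ ∷ x₃ ∷ [])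
    (PT.pair (PT.conj₃ w′ a′ (con 1ℤ :* b′) c′) (PT.conj₃ w′ a′ (con -1ℤ :* b′) c′))
    (PT.conj₂₃ w′ a′ b′ c′) refl

  -- `E` and `F` depend on `a` only through `a²`. Once the squares of `±a` are simplified, both
  -- factors share the same `E` and `F`, which the solver can then treat as variables instead of
  -- expanding them.
  const-pair-conj₂₃ : ∀ w a b c →
    const x₁ x₂ x₃ (pair (conj₂₃ w (1ℤ ℤ.* a) b c) (conj₂₃ w (-1ℤ ℤ.* a) b c)) ≡
    Z.N w (a ℤ.* a ℤ.* x₁) (b ℤ.* b ℤ.* x₂) (c ℤ.* c ℤ.* x₃)
  const-pair-conj₂₃ w a b c = begin
    const x₁ x₂ x₃ (pair (conj₂₃ w (1ℤ ℤ.* a) b c) (conj₂₃ w (-1ℤ ℤ.* a) b c))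
      ≡⟨ cong₂ (λ s t → const x₁ x₂ x₃ (pair (up (h s (1ℤ ℤ.* a))) (up (h t (-1ℤ ℤ.* a)))))
           (solve 1 (λ a → con 1ℤ :* a :* (con 1ℤ :* a) := a :* a) refl a)
           (solve 1 (λ a → con -1ℤ :* a :* (con -1ℤ :* a) := a :* a) refl a) ⟩
    const x₁ x₂ x₃ (pair (up (h (a ℤ.* a) (1ℤ ℤ.* a))) (up (h (a ℤ.* a) (-1ℤ ℤ.* a))))
      ≡⟨ prove (e ∷ f ∷ a ∷ x₁ ∷ x₂ ∷ x₃ ∷ [])
           (proj₁ (proj₁ (proj₁ (QT.pair (QT.up (e′ , con 1ℤ :* a″ :* f′))
                                         (QT.up (e′ , con -1ℤ :* a″ :* f′))))))
           (e′ :* e′ :+ con -1ℤ :* (a″ :* a″ :* var (# 3) :* (f′ :* f′))) refl ⟩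
    Z.N w (a ℤ.* a ℤ.* x₁) (b ℤ.* b ℤ.* x₂) (c ℤ.* c ℤ.* x₃) ∎
    where
    open ≡-Reasoning
    h : ℤ → ℤ → ℤ × ℤ
    h s a = Z.E w (s ℤ.* x₁) (b ℤ.* b ℤ.* x₂) (c ℤ.* c ℤ.* x₃) ,
            a ℤ.* Z.F w (s ℤ.* x₁) (b ℤ.* b ℤ.* x₂) (c ℤ.* c ℤ.* x₃)
    module QT = P.Tower 6 (var (# 3)) (var (# 4)) (var (# 5))
    e f : ℤ
    e = Z.E w (a ℤ.* a ℤ.* x₁) (b ℤ.* b ℤ.* x₂) (c ℤ.* c ℤ.* x₃)
    f = Z.F w (a ℤ.* a ℤ.* x₁) (b ℤ.* b ℤ.* x₂) (c ℤ.* c ℤ.* x₃)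
    e′ f′ a″ : Polynomial 6
    e′ = var (# 0)
    f′ = var (# 1)
    a″ = var (# 2)

  factor : (y p r e₁ e₂ e₃ : ℤ) → Carrier T₃
  factor y p r e₁ e₂ e₃ =
    add T₃ (mul T₃ (inj T₃ p) (add T₃ (inj T₃ (- y)) (S x₁ x₂ x₃ e₁ e₂ e₃))) (inj T₃ r)

  factor≡linear : ∀ y p r e₁ e₂ e₃ → factor y p r e₁ e₂ e₃ ≡
    linear (r ℤ.- p ℤ.* y) (e₁ ℤ.* p) (e₂ ℤ.* (+ 2 ℤ.* p)) (e₃ ℤ.* (+ 4 ℤ.* p))
  factor≡linear y p r e₁ e₂ e₃ = proveTuple (y ∷ p ∷ r ∷ e₁ ∷ e₂ ∷ e₃ ∷ x₁ ∷ x₂ ∷ x₃ ∷ [])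
    (PA.add
      (PA.mul (QT.constant p′) (PA.add (QT.constant (:- y′))
        (PA.add (PA.mul (QT.constant s₁) (QT.linear 0ₚ 1ₚ 0ₚ 0ₚ))
        (PA.add (PA.mul (QT.constant (con (+ 2) :* s₂)) (QT.linear 0ₚ 0ₚ 1ₚ 0ₚ))
                (PA.mul (QT.constant (con (+ 4) :* s₃)) (QT.linear 0ₚ 0ₚ 0ₚ 1ₚ))))))
      (QT.constant r′))
    (QT.linear (r′ :- p′ :* y′) (s₁ :* p′) (s₂ :* (con (+ 2) :* p′)) (s₃ :* (con (+ 4) :* p′))) refl
    where
    module QT = P.Tower 9 (var (# 6)) (var (# 7)) (var (# 8))
    module PA = Alg QT.T₃
    0ₚ 1ₚ y′ p′ r′ s₁ s₂ s₃ : Polynomial 9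
    0ₚ = con 0ℤ
    1ₚ = con 1ℤ
    y′ = var (# 0)
    p′ = var (# 1)
    r′ = var (# 2)
    s₁ = var (# 3)
    s₂ = var (# 4)
    s₃ = var (# 5)

-- Identification of `K₂` with the norm.

-- Unfolding K₂ and comparing it with the same product written in terms of T₃ is
-- exponential: the abbreviations private to Defs make the two sides syntactically
-- different at every level.  Instead, unification reads off the factors.  An
-- integer expression can only be matched against a metavariable when evaluation
-- is not blocked by it, that is, when the leftmost summand and the leftmost factor
-- are known; spine and leaf have that shape (all other arguments are solved), and
-- each equation passed to pair₁, pair₂ and pair₃ unfolds a single multiplication.
module Unfolding (x₁ x₂ x₃ : ℤ) where
  open Z.Tower x₁ x₂ x₃

  private
    T : Set
    T = Carrier T₃
    infixl 7 _⊗_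
    _⊗_ : T → T → T
    _⊗_ = mul T₃
    1# : T
    1# = inj T₃ 1ℤ
    co : T → ℤ
    co = const x₁ x₂ x₃

  spine₀ : (l v a b c : ℤ) → ℤ
  spine₀ l v a b c = l ℤ.* v ℤ.+ a ℤ.+ b ℤ.+ c

  spine : ℤ → (v a b c : T) → T
  spine l (((v₀ , v₁) , (v₂ , v₃)) , ((v₄ , v₅) , (v₆ , v₇)))
          (((a₀ , a₁) , (a₂ , a₃)) , ((a₄ , a₅) , (a₆ , a₇)))
          (((b₀ , b₁) , (b₂ , b₃)) , ((b₄ , b₅) , (b₆ , b₇)))
          (((c₀ , c₁) , (c₂ , c₃)) , ((c₄ , c₅) , (c₆ , c₇))) =
    ((s v₀ a₀ b₀ c₀ , s v₁ a₁ b₁ c₁) , (s v₂ a₂ b₂ c₂ , s v₃ a₃ b₃ c₃)) ,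
    ((s v₄ a₄ b₄ c₄ , s v₅ a₅ b₅ c₅) , (s v₆ a₆ b₆ c₆ , s v₇ a₇ b₇ c₇))
    where
    s : ℤ → ℤ → ℤ → ℤ → ℤ
    s = spine₀ l

  leaf₀ : (p v a b c d : ℤ) → ℤ
  leaf₀ p v a b c d = spine₀ p v a b c ℤ.+ d

  leaf : ℤ → (v a b c d : T) → T
  leaf p v a b c d = add T₃ (spine p v a b c) d

  pair₃ : ∀ {p M v a b c d v′ a′ b′ c′ d′ B s t} →
    M ≡ leaf p v a b c d ⊗ B → B ≡ leaf p v′ a′ b′ c′ d′ ⊗ 1# →
    leaf p v a b c d ≡ s → leaf p v′ a′ b′ c′ d′ ≡ t → M ≡ pair s t
  pair₃ refl refl refl refl = refl

  pair₂ : ∀ {p M v a b c d v₁ a₁ b₁ c₁ v′ a′ b′ c′ d′ v₁′ a₁′ b₁′ c₁′ B s t} →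
    M ≡ spine (leaf₀ p v a b c d) v₁ a₁ b₁ c₁ ⊗ B →
    B ≡ spine (leaf₀ p v′ a′ b′ c′ d′) v₁′ a₁′ b₁′ c₁′ ⊗ 1# →
    spine (leaf₀ p v a b c d) v₁ a₁ b₁ c₁ ≡ s →
    spine (leaf₀ p v′ a′ b′ c′ d′) v₁′ a₁′ b₁′ c₁′ ≡ t → M ≡ pair s t
  pair₂ refl refl refl refl = refl

  pair₁ : ∀ {p k v a b c d v₁ a₁ b₁ c₁ v₂ a₂ b₂ c₂ v′ a′ b′ c′ d′ v₁′ a₁′ b₁′ c₁′ v₂′ a₂′ b₂′ c₂′ B s t} →
    k ≡ co (spine (spine₀ (leaf₀ p v a b c d) v₁ a₁ b₁ c₁) v₂ a₂ b₂ c₂ ⊗ B) →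
    B ≡ spine (spine₀ (leaf₀ p v′ a′ b′ c′ d′) v₁′ a₁′ b₁′ c₁′) v₂′ a₂′ b₂′ c₂′ ⊗ 1# →
    spine (spine₀ (leaf₀ p v a b c d) v₁ a₁ b₁ c₁) v₂ a₂ b₂ c₂ ≡ s →
    spine (spine₀ (leaf₀ p v′ a′ b′ c′ d′) v₁′ a₁′ b₁′ c₁′) v₂′ a₂′ b₂′ c₂′ ≡ t → k ≡ co (pair s t)
  pair₁ refl refl refl refl = refl

  module _ (y p r : ℤ) where
    π₃ : (e₁ e₂ e₃ : ℤ) → T
    π₃ = factor x₁ x₂ x₃ y p r
    π₂ : (e₁ e₂ : ℤ) → T
    π₂ e₁ e₂ = pair (π₃ e₁ e₂ 1ℤ) (π₃ e₁ e₂ -1ℤ)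
    π₁ : (e₁ : ℤ) → T
    π₁ e₁ = pair (π₂ e₁ 1ℤ) (π₂ e₁ -1ℤ)

    K₂≡const-pair : K₂ y x₁ x₂ x₃ p r ≡ co (pair (π₁ 1ℤ) (π₁ -1ℤ))
    K₂≡const-pair = pair₁ {p = p} {s = π₁ 1ℤ} {t = π₁ -1ℤ} refl refl
      (pair₂ {p = p} {s = π₂ 1ℤ 1ℤ} {t = π₂ 1ℤ -1ℤ} refl refl
        (pair₃ {p = p} {s = π₃ 1ℤ 1ℤ 1ℤ} {t = π₃ 1ℤ 1ℤ -1ℤ} refl refl refl refl)
        (pair₃ {p = p} {s = π₃ 1ℤ -1ℤ 1ℤ} {t = π₃ 1ℤ -1ℤ -1ℤ} refl refl refl refl))
      (pair₂ {p = p} {s = π₂ -1ℤ 1ℤ} {t = π₂ -1ℤ -1ℤ} refl refl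
        (pair₃ {p = p} {s = π₃ -1ℤ 1ℤ 1ℤ} {t = π₃ -1ℤ 1ℤ -1ℤ} refl refl refl refl)
        (pair₃ {p = p} {s = π₃ -1ℤ -1ℤ 1ℤ} {t = π₃ -1ℤ -1ℤ -1ℤ} refl refl refl refl))

    private
      w : ℤ
      w = r ℤ.- p ℤ.* y
    open ≡-Reasoning

    π₂≡conj₃ : ∀ e₁ e₂ → π₂ e₁ e₂ ≡ conj₃ w (e₁ ℤ.* p) (e₂ ℤ.* (+ 2 ℤ.* p)) (+ 4 ℤ.* p)
    π₂≡conj₃ e₁ e₂ = trans
      (cong₂ pair (factor≡linear x₁ x₂ x₃ y p r e₁ e₂ 1ℤ) (factor≡linear x₁ x₂ x₃ y p r e₁ e₂ -1ℤ))
      (pair-linear x₁ x₂ x₃ w (e₁ ℤ.* p) (e₂ ℤ.* (+ 2 ℤ.* p)) (+ 4 ℤ.* p))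

    π₁≡conj₂₃ : ∀ e₁ → π₁ e₁ ≡ conj₂₃ w (e₁ ℤ.* p) (+ 2 ℤ.* p) (+ 4 ℤ.* p)
    π₁≡conj₂₃ e₁ = begin
      pair (π₂ e₁ 1ℤ) (π₂ e₁ -1ℤ)
        ≡⟨ cong (λ s → pair s (π₂ e₁ -1ℤ)) (π₂≡conj₃ e₁ 1ℤ) ⟩
      pair (conj₃ w (e₁ ℤ.* p) (1ℤ ℤ.* (+ 2 ℤ.* p)) (+ 4 ℤ.* p)) (π₂ e₁ -1ℤ)
        ≡⟨ cong (pair (conj₃ w (e₁ ℤ.* p) (1ℤ ℤ.* (+ 2 ℤ.* p)) (+ 4 ℤ.* p))) (π₂≡conj₃ e₁ -1ℤ) ⟩
      pair (conj₃ w (e₁ ℤ.* p) (1ℤ ℤ.* (+ 2 ℤ.* p)) (+ 4 ℤ.* p))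
           (conj₃ w (e₁ ℤ.* p) (-1ℤ ℤ.* (+ 2 ℤ.* p)) (+ 4 ℤ.* p))
        ≡⟨ pair-conj₃ x₁ x₂ x₃ w (e₁ ℤ.* p) (+ 2 ℤ.* p) (+ 4 ℤ.* p) ⟩
      conj₂₃ w (e₁ ℤ.* p) (+ 2 ℤ.* p) (+ 4 ℤ.* p) ∎

    K₂≡norm : K₂ y x₁ x₂ x₃ p r ≡ norm p x₁ x₂ x₃ w
    K₂≡norm = begin
      K₂ y x₁ x₂ x₃ p r
        ≡⟨ K₂≡const-pair ⟩
      co (pair (π₁ 1ℤ) (π₁ -1ℤ))
        ≡⟨ cong (λ s → co (pair s (π₁ -1ℤ))) (π₁≡conj₂₃ 1ℤ) ⟩
      co (pair (conj₂₃ w (1ℤ ℤ.* p) (+ 2 ℤ.* p) (+ 4 ℤ.* p)) (π₁ -1ℤ))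
        ≡⟨ cong (λ s → co (pair (conj₂₃ w (1ℤ ℤ.* p) (+ 2 ℤ.* p) (+ 4 ℤ.* p)) s)) (π₁≡conj₂₃ -1ℤ) ⟩
      co (pair (conj₂₃ w (1ℤ ℤ.* p) (+ 2 ℤ.* p) (+ 4 ℤ.* p)) (conj₂₃ w (-1ℤ ℤ.* p) (+ 2 ℤ.* p) (+ 4 ℤ.* p)))
        ≡⟨ const-pair-conj₂₃ x₁ x₂ x₃ w p (+ 2 ℤ.* p) (+ 4 ℤ.* p) ⟩
      norm p x₁ x₂ x₃ w ∎

K≡norm : ∀ y x₁ x₂ x₃ p r n v →
  K y x₁ x₂ x₃ p r n v ≡ norm p x₁ x₂ x₃ (r ℤ.- p ℤ.* (y ℤ.- n ℤ.* v))
K≡norm y x₁ x₂ x₃ p r n v = Unfolding.K₂≡norm x₁ x₂ x₃ (y ℤ.- n ℤ.* v) p r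

-- Integer square roots from vanishing differences of squares.

[m*n]²≡m²*n² : ∀ m n → m * n * (m * n) ≡ m * m * (n * n)
[m*n]²≡m²*n² m n = ℕ.[m*n]*[o*p]≡[m*o]*[n*p] m n m n

-- Dividing by the gcd leaves coprime `k′` and `l′` with `k′² ∣ l′²`. Then `k′` divides `l′ * l′`,
-- hence `l′` by coprimality, so `k′` is 1 and the gcd is `k` itself.
k²∣l²⇒k∣l : ∀ {k l} .{{_ : NonZero k}} → k * k ∣ l * l → k ∣ l
k²∣l²⇒k∣l {k} {l} k²∣l² = subst (_∣ l) g≡k (gcd[m,n]∣n k l)
  where
  g : ℕ
  g = gcd k l
  instance
    g≢0 : NonZero g
    g≢0 = ℕ.≢-nonZero (gcd[m,n]≢0 k l (inj₁ (ℕ.≢-nonZero⁻¹ k)))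
  k′ l′ : ℕ
  k′ = k / g
  l′ = l / g
  k′g≡k : k′ * g ≡ k
  k′g≡k = m/n*n≡m (gcd[m,n]∣m k l)
  l′g≡l : l′ * g ≡ l
  l′g≡l = m/n*n≡m (gcd[m,n]∣n k l)
  coprime : Coprime k′ l′
  coprime = coprime-/gcd k l
  k′²∣l′² : k′ * k′ ∣ l′ * l′
  k′²∣l′² = ℕ.*-cancelʳ-∣ (g * g) {{ℕ.m*n≢0 g g}}
    (subst₂ _∣_ (trans (cong (λ z → z * z) (sym k′g≡k)) ([m*n]²≡m²*n² k′ g))
                (trans (cong (λ z → z * z) (sym l′g≡l)) ([m*n]²≡m²*n² l′ g)) k²∣l²)
  k′≡1 : k′ ≡ 1
  k′≡1 = coprime (ℕ.∣-refl , coprime-divisor coprime (ℕ.∣-trans (ℕ.m∣m*n k′) k′²∣l′²))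
  g≡k : g ≡ k
  g≡k = trans (sym (ℕ.*-identityˡ g)) (trans (cong (_* g) (sym k′≡1)) k′g≡k)

square-root : ∀ m {k l} .{{_ : NonZero k}} → m * (k * k) ≡ l * l → ∃ λ s → m ≡ s * s
square-root m {k} {l} eq = quotient-square (k²∣l²⇒k∣l (divides m (sym eq)))
  where
  quotient-square : k ∣ l → ∃ λ s → m ≡ s * s
  quotient-square (divides s refl) =
    s , ℕ.*-cancelʳ-≡ m (s * s) (k * k) {{ℕ.m*n≢0 k k}} (trans eq ([m*n]²≡m²*n² s k))

i≢0∧j≢0⇒i*j≢0 : ∀ i {j} → i ≢ 0ℤ → j ≢ 0ℤ → i ℤ.* j ≢ 0ℤ
i≢0∧j≢0⇒i*j≢0 i i≢0 j≢0 eq = [ i≢0 , j≢0 ]′ (ℤ.i*j≡0⇒i≡0∨j≡0 i eq)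

i*i≡0⇒i≡0 : ∀ i → i ℤ.* i ≡ 0ℤ → i ≡ 0ℤ
i*i≡0⇒i≡0 i eq = [ id , id ]′ (ℤ.i*j≡0⇒i≡0∨j≡0 i eq)

-- Since `m(qk)² = l²` with `qk` nonzero, `m = s²` and `(l + qsk)(l - qsk) = 0`. The sign of
-- `a = ±s` is chosen according to the factor that vanishes. Each application replaces one formal
-- square root `√m` by an integer.
signed-root : ∀ m q k l → q ≢ 0ℤ → k ≢ 0ℤ → q ℤ.* q ℤ.* + m ℤ.* (k ℤ.* k) ≡ l ℤ.* l →
  ∃ λ a → a ℤ.* a ≡ + m × l ℤ.+ q ℤ.* a ℤ.* k ≡ 0ℤ
signed-root m q k l q≢0 k≢0 eq = signed (square-root m {∣ q ℤ.* k ∣} {∣ l ∣} {{qk≢0}} eqℕ)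
  where
  open ≡-Reasoning
  qk≢0 : NonZero ∣ q ℤ.* k ∣
  qk≢0 = ℕ.≢-nonZero (λ z → i≢0∧j≢0⇒i*j≢0 q q≢0 k≢0 (ℤ.∣i∣≡0⇒i≡0 z))
  eqℕ : m * (∣ q ℤ.* k ∣ * ∣ q ℤ.* k ∣) ≡ ∣ l ∣ * ∣ l ∣
  eqℕ = begin
    m * (∣ q ℤ.* k ∣ * ∣ q ℤ.* k ∣)       ≡⟨ cong (m *_) (sym (ℤ.abs-* (q ℤ.* k) (q ℤ.* k))) ⟩
    m * ∣ q ℤ.* k ℤ.* (q ℤ.* k) ∣         ≡⟨ sym (ℤ.abs-* (+ m) (q ℤ.* k ℤ.* (q ℤ.* k))) ⟩
    ∣ + m ℤ.* (q ℤ.* k ℤ.* (q ℤ.* k)) ∣   ≡⟨ cong ∣_∣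
      (solve 3 (λ m q k → m :* (q :* k :* (q :* k)) := q :* q :* m :* (k :* k)) refl (+ m) q k) ⟩
    ∣ q ℤ.* q ℤ.* + m ℤ.* (k ℤ.* k) ∣     ≡⟨ cong ∣_∣ eq ⟩
    ∣ l ℤ.* l ∣                           ≡⟨ ℤ.abs-* l l ⟩
    ∣ l ∣ * ∣ l ∣                         ∎
  signed : (∃ λ s → m ≡ s * s) → ∃ λ a → a ℤ.* a ≡ + m × l ℤ.+ q ℤ.* a ℤ.* k ≡ 0ℤ
  signed (s , m≡s²) =
    [ (λ z → + s , s²≡m , z)
    , (λ z → - (+ s) , trans (solve 1 (λ s → :- s :* :- s := s :* s) refl (+ s)) s²≡m , z) ]′
    (ℤ.i*j≡0⇒i≡0∨j≡0 (l ℤ.+ q ℤ.* + s ℤ.* k) (begin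
      (l ℤ.+ q ℤ.* + s ℤ.* k) ℤ.* (l ℤ.+ q ℤ.* - (+ s) ℤ.* k)
        ≡⟨ solve 4 (λ q k l s → (l :+ q :* s :* k) :* (l :+ q :* :- s :* k) := l :* l :- q :* q :* (s :* s) :* (k :* k)) refl q k l (+ s) ⟩
      l ℤ.* l ℤ.- q ℤ.* q ℤ.* (+ s ℤ.* + s) ℤ.* (k ℤ.* k)
        ≡⟨ cong (λ z → l ℤ.* l ℤ.- q ℤ.* q ℤ.* z ℤ.* (k ℤ.* k)) s²≡m ⟩
      l ℤ.* l ℤ.- q ℤ.* q ℤ.* + m ℤ.* (k ℤ.* k)
        ≡⟨ ℤ.i≡j⇒i-j≡0 (sym eq) ⟩
      0ℤ ∎))
    where
    s²≡m : + s ℤ.* + s ≡ + m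
    s²≡m = trans (sym (ℤ.pos-* s s)) (cong +_ (sym m≡s²))

-- Extraction of the three roots from a vanishing norm.

Roots : ℤ → ℕ → ℕ → ℕ → ℤ → Set
Roots p x₁ x₂ x₃ w = ∃ λ a → ∃ λ b → ∃ λ c →
  a ℤ.* a ≡ + x₁ × b ℤ.* b ≡ + x₂ × c ℤ.* c ≡ + x₃ ×
  w ℤ.+ p ℤ.* a ℤ.+ + 2 ℤ.* p ℤ.* b ℤ.+ + 4 ℤ.* p ℤ.* c ≡ 0ℤ

-- If F = 0 and w ≠ 0, then D = 2β and therefore E = 4(β - w²)(β - α).
F≢0 : ∀ w α β γ → w ≢ 0ℤ → α ≢ β → α ≢ γ → Z.N w α β γ ≡ 0ℤ → Z.F w α β γ ≢ 0ℤ
F≢0 w α β γ w≢0 α≢β α≢γ N≡0 F≡0 =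
  [ i≢0∧j≢0⇒i*j≢0 (+ 4) (λ ()) w≢0 , D-2β≢0 ]′ (ℤ.i*j≡0⇒i≡0∨j≡0 (+ 4 ℤ.* w) F≡0)
  where
  open ≡-Reasoning
  E≡0 : Z.E w α β γ ≡ 0ℤ
  E≡0 = i*i≡0⇒i≡0 _ (begin
    Z.E w α β γ ℤ.* Z.E w α β γ
      ≡⟨ solve 3 (λ e f α → e :* e := (e :* e :+ con -1ℤ :* (α :* (f :* f))) :+ α :* (f :* f)) refl (Z.E w α β γ) (Z.F w α β γ) α ⟩
    Z.N w α β γ ℤ.+ α ℤ.* (Z.F w α β γ ℤ.* Z.F w α β γ)
      ≡⟨ cong₂ (λ n f → n ℤ.+ α ℤ.* (f ℤ.* f)) N≡0 F≡0 ⟩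
    0ℤ ℤ.+ α ℤ.* 0ℤ ≡⟨ solve 1 (λ α → con 0ℤ :+ α :* con 0ℤ := con 0ℤ) refl α ⟩
    0ℤ ∎)
  D-2β≢0 : Z.D w α β γ ℤ.+ -1ℤ ℤ.* (+ 2 ℤ.* β) ≢ 0ℤ
  -- The first factor is excluded because `β = w²` and `D = 2β` together give `α = γ`.
  D-2β≢0 eq = [ (λ β≡w² → α≢γ (ℤ.i-j≡0⇒i≡j α γ (begin
        α ℤ.- γ ≡⟨ solve 4 (λ w α β γ → α :- γ := (P.D 4 w α β γ :+ con -1ℤ :* (con (+ 2) :* β)) :+ (β :- w :* w)) refl w α β γ ⟩
        Z.D w α β γ ℤ.+ -1ℤ ℤ.* (+ 2 ℤ.* β) ℤ.+ (β ℤ.- w ℤ.* w) ≡⟨ cong₂ ℤ._+_ eq β≡w² ⟩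
        0ℤ ∎)))
    , (λ β≡α → α≢β (sym (ℤ.i-j≡0⇒i≡j β α β≡α))) ]′
    (ℤ.i*j≡0⇒i≡0∨j≡0 (β ℤ.- w ℤ.* w) ([ (λ ()) , id ]′ (ℤ.i*j≡0⇒i≡0∨j≡0 (+ 4) (begin
      + 4 ℤ.* ((β ℤ.- w ℤ.* w) ℤ.* (β ℤ.- α))
        ≡⟨ solve 4 (λ w α β γ → con (+ 4) :* ((β :- w :* w) :* (β :- α)) :=
             P.E 4 w α β γ :- (P.D 4 w α β γ :+ con -1ℤ :* (con (+ 2) :* β)) :* (P.D 4 w α β γ :+ con (+ 2) :* β)) refl w α β γ ⟩
      Z.E w α β γ ℤ.- (Z.D w α β γ ℤ.+ -1ℤ ℤ.* (+ 2 ℤ.* β)) ℤ.* (Z.D w α β γ ℤ.+ + 2 ℤ.* β)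
        ≡⟨ cong₂ (λ e d → e ℤ.- d ℤ.* (Z.D w α β γ ℤ.+ + 2 ℤ.* β)) E≡0 eq ⟩
      0ℤ ∎))))

module _ (x₁ x₂ x₃ : ℕ) (p w : ℤ) (p≢0 : p ≢ 0ℤ) where
  private
    α β γ : ℤ
    α = p ℤ.* p ℤ.* + x₁
    β = + 2 ℤ.* p ℤ.* (+ 2 ℤ.* p) ℤ.* + x₂
    γ = + 4 ℤ.* p ℤ.* (+ 4 ℤ.* p) ℤ.* + x₃
    2p≢0 : + 2 ℤ.* p ≢ 0ℤ
    2p≢0 = i≢0∧j≢0⇒i*j≢0 (+ 2) (λ ()) p≢0
    4p≢0 : + 4 ℤ.* p ≢ 0ℤ
    4p≢0 = i≢0∧j≢0⇒i*j≢0 (+ 4) (λ ()) p≢0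
    scaled : ∀ q a x → a ℤ.* a ≡ + x → q ℤ.* q ℤ.* + x ≡ q ℤ.* a ℤ.* (q ℤ.* a)
    scaled q a x eq = trans (cong (λ z → q ℤ.* q ℤ.* z) (sym eq))
      (solve 2 (λ q a → q :* q :* (a :* a) := q :* a :* (q :* a)) refl q a)

    open ≡-Reasoning

  root₁ : w ≢ 0ℤ → α ≢ β → α ≢ γ → Z.N w α β γ ≡ 0ℤ →
    ∃ λ a → a ℤ.* a ≡ + x₁ × Z.E w α β γ ℤ.+ p ℤ.* a ℤ.* Z.F w α β γ ≡ 0ℤ
  root₁ w≢0 α≢β α≢γ N≡0 = signed-root x₁ p (Z.F w α β γ) (Z.E w α β γ) p≢0 (F≢0 w α β γ w≢0 α≢β α≢γ N≡0)
    (sym (ℤ.i-j≡0⇒i≡j _ _ (trans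
      (solve 3 (λ e f α → e :* e :- α :* (f :* f) := e :* e :+ con -1ℤ :* (α :* (f :* f))) refl (Z.E w α β γ) (Z.F w α β γ) α) N≡0)))

  -- With the integer `A` in place of `√α`, `E + AF` is the difference of squares
  -- `D′² - β(2(w + A))²`.
  root₂ : ∀ A → α ≡ A ℤ.* A → β ≢ γ → Z.E w α β γ ℤ.+ A ℤ.* Z.F w α β γ ≡ 0ℤ →
    ∃ λ b → b ℤ.* b ≡ + x₂ ×
      Z.D w (A ℤ.* A) β γ ℤ.+ + 2 ℤ.* (w ℤ.* A) ℤ.+ + 2 ℤ.* p ℤ.* b ℤ.* (+ 2 ℤ.* (w ℤ.+ A)) ≡ 0ℤ
  root₂ A α≡A² β≢γ E+AF≡0 = signed-root x₂ (+ 2 ℤ.* p) (+ 2 ℤ.* (w ℤ.+ A)) D′ 2p≢0 k≢0 βk²≡D′²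
    where
    D′ : ℤ
    D′ = Z.D w (A ℤ.* A) β γ ℤ.+ + 2 ℤ.* (w ℤ.* A)
    βk²≡D′² : β ℤ.* (+ 2 ℤ.* (w ℤ.+ A) ℤ.* (+ 2 ℤ.* (w ℤ.+ A))) ≡ D′ ℤ.* D′
    βk²≡D′² = sym (ℤ.i-j≡0⇒i≡j _ _ (begin
      D′ ℤ.* D′ ℤ.- β ℤ.* (+ 2 ℤ.* (w ℤ.+ A) ℤ.* (+ 2 ℤ.* (w ℤ.+ A)))
        ≡⟨ solve 4 (λ w A β γ →
             (P.D 4 w (A :* A) β γ :+ con (+ 2) :* (w :* A)) :* (P.D 4 w (A :* A) β γ :+ con (+ 2) :* (w :* A))
               :- β :* (con (+ 2) :* (w :+ A) :* (con (+ 2) :* (w :+ A)))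
             := P.E 4 w (A :* A) β γ :+ A :* P.F 4 w (A :* A) β γ) refl w A β γ ⟩
      Z.E w (A ℤ.* A) β γ ℤ.+ A ℤ.* Z.F w (A ℤ.* A) β γ
        ≡⟨ cong (λ α → Z.E w α β γ ℤ.+ A ℤ.* Z.F w α β γ) (sym α≡A²) ⟩
      Z.E w α β γ ℤ.+ A ℤ.* Z.F w α β γ ≡⟨ E+AF≡0 ⟩
      0ℤ ∎))
    -- If `w + A = 0`, then `D′² = 0`. As `D′ = (w + A)² + β - γ`, this would give `β = γ`.
    k≢0 : + 2 ℤ.* (w ℤ.+ A) ≢ 0ℤ
    k≢0 = i≢0∧j≢0⇒i*j≢0 (+ 2) (λ ()) λ w+A≡0 → β≢γ (ℤ.i-j≡0⇒i≡j β γ (begin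
      β ℤ.- γ
        ≡⟨ solve 4 (λ w A β γ → β :- γ := (P.D 4 w (A :* A) β γ :+ con (+ 2) :* (w :* A)) :- (w :+ A) :* (w :+ A)) refl w A β γ ⟩
      D′ ℤ.- (w ℤ.+ A) ℤ.* (w ℤ.+ A)
        ≡⟨ cong₂ (λ d s → d ℤ.- s ℤ.* s) (i*i≡0⇒i≡0 D′ (begin
             D′ ℤ.* D′
               ≡⟨ sym βk²≡D′² ⟩
             β ℤ.* (+ 2 ℤ.* (w ℤ.+ A) ℤ.* (+ 2 ℤ.* (w ℤ.+ A)))
               ≡⟨ cong (λ s → β ℤ.* (+ 2 ℤ.* s ℤ.* (+ 2 ℤ.* s))) w+A≡0 ⟩
             β ℤ.* 0ℤ
               ≡⟨ ℤ.*-zeroʳ β ⟩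
             0ℤ ∎)) w+A≡0 ⟩
      0ℤ ∎))

  -- The left side of the hypothesis is `(w + A + B)² - γ`, where `√γ` has coefficient 1. This is
  -- the `k` of `signed-root` and explains the trailing `1ℤ`, which `roots` removes.
  root₃ : ∀ A B → β ≡ B ℤ.* B →
    Z.D w (A ℤ.* A) β γ ℤ.+ + 2 ℤ.* (w ℤ.* A) ℤ.+ B ℤ.* (+ 2 ℤ.* (w ℤ.+ A)) ≡ 0ℤ →
    ∃ λ c → c ℤ.* c ≡ + x₃ × w ℤ.+ A ℤ.+ B ℤ.+ + 4 ℤ.* p ℤ.* c ℤ.* 1ℤ ≡ 0ℤ
  root₃ A B β≡B² D′+Bk≡0 = signed-root x₃ (+ 4 ℤ.* p) 1ℤ (w ℤ.+ A ℤ.+ B) 4p≢0 (λ ()) (sym (ℤ.i-j≡0⇒i≡j _ _ (begin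
      (w ℤ.+ A ℤ.+ B) ℤ.* (w ℤ.+ A ℤ.+ B) ℤ.- γ ℤ.* (1ℤ ℤ.* 1ℤ)
        ≡⟨ solve 4 (λ w A B γ → (w :+ A :+ B) :* (w :+ A :+ B) :- γ :* (con 1ℤ :* con 1ℤ)
             := P.D 4 w (A :* A) (B :* B) γ :+ con (+ 2) :* (w :* A) :+ B :* (con (+ 2) :* (w :+ A))) refl w A B γ ⟩
      Z.D w (A ℤ.* A) (B ℤ.* B) γ ℤ.+ + 2 ℤ.* (w ℤ.* A) ℤ.+ B ℤ.* (+ 2 ℤ.* (w ℤ.+ A))
        ≡⟨ cong (λ β → Z.D w (A ℤ.* A) β γ ℤ.+ + 2 ℤ.* (w ℤ.* A) ℤ.+ B ℤ.* (+ 2 ℤ.* (w ℤ.+ A))) (sym β≡B²) ⟩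
      Z.D w (A ℤ.* A) β γ ℤ.+ + 2 ℤ.* (w ℤ.* A) ℤ.+ B ℤ.* (+ 2 ℤ.* (w ℤ.+ A)) ≡⟨ D′+Bk≡0 ⟩
      0ℤ ∎)))

  roots : w ≢ 0ℤ → α ≢ β → α ≢ γ → β ≢ γ → Z.N w α β γ ≡ 0ℤ → Roots p x₁ x₂ x₃ w
  roots w≢0 α≢β α≢γ β≢γ N≡0 =
    let a , a²≡x₁ , eq₁ = root₁ w≢0 α≢β α≢γ N≡0
        b , b²≡x₂ , eq₂ = root₂ (p ℤ.* a) (scaled p a x₁ a²≡x₁) β≢γ eq₁
        c , c²≡x₃ , eq₃ = root₃ (p ℤ.* a) (+ 2 ℤ.* p ℤ.* b) (scaled (+ 2 ℤ.* p) b x₂ b²≡x₂) eq₂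
    in a , b , c , a²≡x₁ , b²≡x₂ , c²≡x₃ ,
       trans (cong (λ C → w ℤ.+ p ℤ.* a ℤ.+ + 2 ℤ.* p ℤ.* b ℤ.+ C) (sym (ℤ.*-identityʳ (+ 4 ℤ.* p ℤ.* c)))) eq₃

-- Parity and the degenerate cases.

Odd⇒ℤ : ∀ {x} → Odd x → ∃ λ i → + x ≡ 1ℤ ℤ.+ + 2 ℤ.* i
Odd⇒ℤ (k , refl) = + k , cong (λ z → 1ℤ ℤ.+ z) (ℤ.pos-* 2 k)

1+2i≢2j : ∀ i j → 1ℤ ℤ.+ + 2 ℤ.* i ≢ + 2 ℤ.* j
1+2i≢2j i j eq = ℕ.1+n≢n {1} (ℕ.∣1⇒≡1 (divides ∣ j ℤ.- i ∣ (begin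
  1
    ≡⟨ cong ∣_∣ (solve 2 (λ i j → con 1ℤ := con 1ℤ :+ con (+ 2) :* i :- con (+ 2) :* j :+ (j :- i) :* con (+ 2)) refl i j) ⟩
  ∣ 1ℤ ℤ.+ + 2 ℤ.* i ℤ.- + 2 ℤ.* j ℤ.+ (j ℤ.- i) ℤ.* + 2 ∣
    ≡⟨ cong (λ z → ∣ z ℤ.+ (j ℤ.- i) ℤ.* + 2 ∣) (ℤ.i≡j⇒i-j≡0 eq) ⟩
  ∣ 0ℤ ℤ.+ (j ℤ.- i) ℤ.* + 2 ∣
    ≡⟨ cong ∣_∣ (ℤ.+-identityˡ ((j ℤ.- i) ℤ.* + 2)) ⟩
  ∣ (j ℤ.- i) ℤ.* + 2 ∣
    ≡⟨ ℤ.abs-* (j ℤ.- i) (+ 2) ⟩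
  ∣ j ℤ.- i ∣ * 2 ∎)))
  where open ≡-Reasoning

q²*odd≢q²*even : ∀ q {x} j → q ≢ 0ℤ → Odd x → q ℤ.* q ℤ.* + x ≢ q ℤ.* q ℤ.* (+ 2 ℤ.* j)
q²*odd≢q²*even q {x} j q≢0 odd eq =
  let i , x≡1+2i = Odd⇒ℤ odd
  in 1+2i≢2j i j (trans (sym x≡1+2i) (ℤ.*-cancelˡ-≡ (q ℤ.* q) (+ x) (+ 2 ℤ.* j) {{q²≢0}} eq))
  where
  q²≢0 : NonZero ∣ q ℤ.* q ∣
  q²≢0 = ℕ.≢-nonZero (λ z → i≢0∧j≢0⇒i*j≢0 q q≢0 q≢0 (ℤ.∣i∣≡0⇒i≡0 z))

-- At `w = 0` the form `F` vanishes and `E` becomes `(α + β - γ)² - 4αβ`, which is `p⁴` times an odd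
-- number; the norm is its square.
norm-at-0≢0 : ∀ x₁ x₂ x₃ p → p ≢ 0ℤ → Odd x₁ → norm p (+ x₁) (+ x₂) (+ x₃) 0ℤ ≢ 0ℤ
norm-at-0≢0 x₁ x₂ x₃ p p≢0 odd N≡0 = not-zero (Odd⇒ℤ odd)
  (trans (sym δ≡p⁴e) (i*i≡0⇒i≡0 (δ α β γ) (trans (sym (square α β γ)) N≡0)))
  where
  open ≡-Reasoning
  α β γ : ℤ
  α = p ℤ.* p ℤ.* + x₁
  β = + 2 ℤ.* p ℤ.* (+ 2 ℤ.* p) ℤ.* + x₂
  γ = + 4 ℤ.* p ℤ.* (+ 4 ℤ.* p) ℤ.* + x₃
  -- For odd x, e x is the square of an odd number minus an even number.
  e : ℤ → ℤ
  e x = (x ℤ.+ + 4 ℤ.* + x₂ ℤ.- + 16 ℤ.* + x₃) ℤ.* (x ℤ.+ + 4 ℤ.* + x₂ ℤ.- + 16 ℤ.* + x₃) ℤ.- + 16 ℤ.* (x ℤ.* + x₂)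
  δ : ℤ → ℤ → ℤ → ℤ
  δ α β γ = (α ℤ.+ β ℤ.- γ) ℤ.* (α ℤ.+ β ℤ.- γ) ℤ.- + 4 ℤ.* (α ℤ.* β)
  square : ∀ α β γ → Z.N 0ℤ α β γ ≡ δ α β γ ℤ.* δ α β γ
  square = solve 3 (λ α β γ →
    let δ′ = (α :+ β :- γ) :* (α :+ β :- γ) :- con (+ 4) :* (α :* β)
    in P.N 3 (con 0ℤ) α β γ := δ′ :* δ′) refl
  δ≡p⁴e : δ α β γ ≡ p ℤ.* p ℤ.* (p ℤ.* p) ℤ.* e (+ x₁)
  δ≡p⁴e = solve 4 (λ p x₁ x₂ x₃ →
    let α′ = p :* p :* x₁
        β′ = con (+ 2) :* p :* (con (+ 2) :* p) :* x₂
        s = α′ :+ β′ :- con (+ 4) :* p :* (con (+ 4) :* p) :* x₃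
        t = x₁ :+ con (+ 4) :* x₂ :- con (+ 16) :* x₃
    in s :* s :- con (+ 4) :* (α′ :* β′) := p :* p :* (p :* p) :* (t :* t :- con (+ 16) :* (x₁ :* x₂)))
    refl p (+ x₁) (+ x₂) (+ x₃)
  p²≢0 : p ℤ.* p ≢ 0ℤ
  p²≢0 = i≢0∧j≢0⇒i*j≢0 p p≢0 p≢0
  not-zero : (∃ λ i → + x₁ ≡ 1ℤ ℤ.+ + 2 ℤ.* i) → p ℤ.* p ℤ.* (p ℤ.* p) ℤ.* e (+ x₁) ≢ 0ℤ
  not-zero (i , x₁≡1+2i) =
    i≢0∧j≢0⇒i*j≢0 (p ℤ.* p ℤ.* (p ℤ.* p)) (i≢0∧j≢0⇒i*j≢0 (p ℤ.* p) p²≢0 p²≢0) λ e≡0 →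
      1+2i≢2j j 0ℤ (begin
        1ℤ ℤ.+ + 2 ℤ.* j
          ≡⟨ solve 3 (λ i x z →
               let m′ = i :+ con (+ 2) :* x :- con (+ 8) :* z
                   s = con 1ℤ :+ con (+ 2) :* i :+ con (+ 4) :* x :- con (+ 16) :* z
               in con 1ℤ :+ con (+ 2) :* (con (+ 2) :* m′ :+ con (+ 2) :* (m′ :* m′) :- con (+ 8) :* ((con 1ℤ :+ con (+ 2) :* i) :* x))
                  := s :* s :- con (+ 16) :* ((con 1ℤ :+ con (+ 2) :* i) :* x)) refl i (+ x₂) (+ x₃) ⟩
        e (1ℤ ℤ.+ + 2 ℤ.* i) ≡⟨ cong e (sym x₁≡1+2i) ⟩
        e (+ x₁)             ≡⟨ e≡0 ⟩
        0ℤ                   ∎)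
    where
    m j : ℤ
    -- With `s = x₁ + 4x₂ - 16x₃ = 1 + 2m`, the value `s² - 16x₁x₂` of `e` is `1 + 2j`.
    m = i ℤ.+ + 2 ℤ.* + x₂ ℤ.- + 8 ℤ.* + x₃
    j = + 2 ℤ.* m ℤ.+ + 2 ℤ.* (m ℤ.* m) ℤ.- + 8 ℤ.* ((1ℤ ℤ.+ + 2 ℤ.* i) ℤ.* + x₂)

-- Dividing `α`, `β`, `γ` by `p²` gives `x₁`, `4x₂`, `16x₃`, so odd `x₁` separates `α` from the
-- other two. Dividing `β` and `γ` by `(2p)²` gives `x₂` and `4x₃`, so odd `x₂` separates these.
odd-roots : ∀ x₁ x₂ x₃ p w → p ≢ 0ℤ → Odd x₁ → Odd x₂ →
  norm p (+ x₁) (+ x₂) (+ x₃) w ≡ 0ℤ → Roots p x₁ x₂ x₃ w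
odd-roots x₁ x₂ x₃ p w p≢0 odd₁ odd₂ N≡0 = roots x₁ x₂ x₃ p w p≢0
  (λ w≡0 → norm-at-0≢0 x₁ x₂ x₃ p p≢0 odd₁ (trans (cong (λ w → Z.N w α β γ) (sym w≡0)) N≡0))
  (λ α≡β → q²*odd≢q²*even p (+ 2 ℤ.* + x₂) p≢0 odd₁ (trans α≡β
    (solve 2 (λ p x → con (+ 2) :* p :* (con (+ 2) :* p) :* x := p :* p :* (con (+ 2) :* (con (+ 2) :* x))) refl p (+ x₂))))
  (λ α≡γ → q²*odd≢q²*even p (+ 8 ℤ.* + x₃) p≢0 odd₁ (trans α≡γ
    (solve 2 (λ p x → con (+ 4) :* p :* (con (+ 4) :* p) :* x := p :* p :* (con (+ 2) :* (con (+ 8) :* x))) refl p (+ x₃))))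
  (λ β≡γ → q²*odd≢q²*even (+ 2 ℤ.* p) (+ 2 ℤ.* + x₃) (i≢0∧j≢0⇒i*j≢0 (+ 2) (λ ()) p≢0) odd₂ (trans β≡γ
    (solve 2 (λ p x → con (+ 4) :* p :* (con (+ 4) :* p) :* x :=
      con (+ 2) :* p :* (con (+ 2) :* p) :* (con (+ 2) :* (con (+ 2) :* x))) refl p (+ x₃))))
  N≡0
  where
  α β γ : ℤ
  α = p ℤ.* p ℤ.* + x₁
  β = + 2 ℤ.* p ℤ.* (+ 2 ℤ.* p) ℤ.* + x₂
  γ = + 4 ℤ.* p ℤ.* (+ 4 ℤ.* p) ℤ.* + x₃

-- Size estimates.

m²d²≤n²⇒md≤n : ∀ m d n → m * m * (d * d) ℕ.≤ n * n → m * d ℕ.≤ n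
m²d²≤n²⇒md≤n m d n m²d²≤n² with m * d ℕ.≤? n
... | yes md≤n = md≤n
... | no  md≰n = contradiction m²d²≤n² (ℕ.<⇒≱
  (subst (n * n <_) ([m*n]²≡m²*n² m d) (ℕ.*-mono-< (ℕ.≰⇒> md≰n) (ℕ.≰⇒> md≰n))))

-- For perfect squares the rational bounds `a′/d`, `b′/d`, `c′/d` are at least the roots `a`, `b`,
-- `c`. The comparison is made after multiplying by `d`, which is then cancelled.
roots-bounded : ∀ {r n} a b c → SqrtBound (a * a) (b * b) (c * c) r n → a ℕ.+ 2 * b ℕ.+ 4 * c ℕ.+ r < n
roots-bounded {r} {n} a b c (a′ , b′ , c′ , d , _ , a≤ , b≤ , c≤ , lt) = ℕ.*-cancelʳ-< d _ n (begin-strict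
  (a ℕ.+ 2 * b ℕ.+ 4 * c ℕ.+ r) * d
    ≡⟨ ℕS.solve 5 (λ a b c r d → (a ℕS.:+ ℕS.con 2 ℕS.:* b ℕS.:+ ℕS.con 4 ℕS.:* c ℕS.:+ r) ℕS.:* d ℕS.:=
         a ℕS.:* d ℕS.:+ ℕS.con 2 ℕS.:* (b ℕS.:* d) ℕS.:+ ℕS.con 4 ℕS.:* (c ℕS.:* d) ℕS.:+ r ℕS.:* d) refl a b c r d ⟩
  a * d ℕ.+ 2 * (b * d) ℕ.+ 4 * (c * d) ℕ.+ r * d
    ≤⟨ ℕ.+-monoˡ-≤ (r * d) (ℕ.+-mono-≤ (ℕ.+-mono-≤ (m²d²≤n²⇒md≤n a d a′ a≤)
         (ℕ.*-monoʳ-≤ 2 (m²d²≤n²⇒md≤n b d b′ b≤))) (ℕ.*-monoʳ-≤ 4 (m²d²≤n²⇒md≤n c d c′ c≤))) ⟩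
  a′ ℕ.+ 2 * b′ ℕ.+ 4 * c′ ℕ.+ r * d
    <⟨ lt ⟩
  n * d ∎)
  where open ℕ.≤-Reasoning

a*a≡+x⇒x≡∣a∣*∣a∣ : ∀ a {x} → a ℤ.* a ≡ + x → x ≡ ∣ a ∣ * ∣ a ∣
a*a≡+x⇒x≡∣a∣*∣a∣ a eq = trans (cong ∣_∣ (sym eq)) (ℤ.abs-* a a)

∣a+2b+4c+k∣≤ : ∀ a b c k → ∣ a ℤ.+ + 2 ℤ.* b ℤ.+ + 4 ℤ.* c ℤ.+ k ∣ ℕ.≤ ∣ a ∣ ℕ.+ 2 * ∣ b ∣ ℕ.+ 4 * ∣ c ∣ ℕ.+ ∣ k ∣
∣a+2b+4c+k∣≤ a b c k = begin
  ∣ a ℤ.+ + 2 ℤ.* b ℤ.+ + 4 ℤ.* c ℤ.+ k ∣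
    ≤⟨ ℤ.∣i+j∣≤∣i∣+∣j∣ (a ℤ.+ + 2 ℤ.* b ℤ.+ + 4 ℤ.* c) k ⟩
  ∣ a ℤ.+ + 2 ℤ.* b ℤ.+ + 4 ℤ.* c ∣ ℕ.+ ∣ k ∣
    ≤⟨ ℕ.+-monoˡ-≤ ∣ k ∣ (ℤ.∣i+j∣≤∣i∣+∣j∣ (a ℤ.+ + 2 ℤ.* b) (+ 4 ℤ.* c)) ⟩
  ∣ a ℤ.+ + 2 ℤ.* b ∣ ℕ.+ ∣ + 4 ℤ.* c ∣ ℕ.+ ∣ k ∣
    ≤⟨ ℕ.+-monoˡ-≤ ∣ k ∣ (ℕ.+-monoˡ-≤ ∣ + 4 ℤ.* c ∣ (ℤ.∣i+j∣≤∣i∣+∣j∣ a (+ 2 ℤ.* b))) ⟩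
  ∣ a ∣ ℕ.+ ∣ + 2 ℤ.* b ∣ ℕ.+ ∣ + 4 ℤ.* c ∣ ℕ.+ ∣ k ∣
    ≡⟨ cong₂ (λ s t → ∣ a ∣ ℕ.+ s ℕ.+ t ℕ.+ ∣ k ∣) (ℤ.abs-* (+ 2) b) (ℤ.abs-* (+ 4) c) ⟩
  ∣ a ∣ ℕ.+ 2 * ∣ b ∣ ℕ.+ 4 * ∣ c ∣ ℕ.+ ∣ k ∣ ∎
  where open ℕ.≤-Reasoning

-- The two implications.

K≡0⇒squares : ∀ x₁ x₂ x₃ p r n v → Odd x₁ → Odd x₂ → 0 < p → SqrtBound x₁ x₂ x₃ r n →
  (∃ λ (y : ℕ) → K (+ y) (+ x₁) (+ x₂) (+ x₃) (+ p) (+ r) (+ n) v ≡ 0ℤ) →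
  (∃ λ (a : ℕ) → x₁ ≡ a * a) × (∃ λ (b : ℕ) → x₂ ≡ b * b) ×
  (∃ λ (c : ℕ) → x₃ ≡ c * c) × (p ∣ r) × (0ℤ ≤ℤ v)
K≡0⇒squares x₁ x₂ x₃ p r n v odd₁ odd₂ 0<p bound (y , K≡0) = conclude
  (odd-roots x₁ x₂ x₃ (+ p) (+ r ℤ.- + p ℤ.* Y) (λ p≡0 → ℕ.<⇒≢ 0<p (sym (ℤ.+-injective p≡0))) odd₁ odd₂
    (trans (sym (K≡norm (+ y) (+ x₁) (+ x₂) (+ x₃) (+ p) (+ r) (+ n) v)) K≡0))
  where
  Y : ℤ
  Y = + y ℤ.- + n ℤ.* v
  conclude : Roots (+ p) x₁ x₂ x₃ (+ r ℤ.- + p ℤ.* Y) →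
    (∃ λ (a : ℕ) → x₁ ≡ a * a) × (∃ λ (b : ℕ) → x₂ ≡ b * b) ×
    (∃ λ (c : ℕ) → x₃ ≡ c * c) × (p ∣ r) × (0ℤ ≤ℤ v)
  conclude (a , b , c , a²≡x₁ , b²≡x₂ , c²≡x₃ , eq) =
    (∣ a ∣ , x₁≡) , (∣ b ∣ , x₂≡) , (∣ c ∣ , x₃≡) , divides ∣ k ∣ r≡∣k∣p , nonnegative v refl
    where
    x₁≡ : x₁ ≡ ∣ a ∣ * ∣ a ∣
    x₁≡ = a*a≡+x⇒x≡∣a∣*∣a∣ a a²≡x₁
    x₂≡ : x₂ ≡ ∣ b ∣ * ∣ b ∣
    x₂≡ = a*a≡+x⇒x≡∣a∣*∣a∣ b b²≡x₂
    x₃≡ : x₃ ≡ ∣ c ∣ * ∣ c ∣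
    x₃≡ = a*a≡+x⇒x≡∣a∣*∣a∣ c c²≡x₃
    -- The relation in `Roots` says exactly `r = k * p`, so `k` is the quotient `r/p`. Moreover
    -- `Y = a + 2b + 4c + k` and `∣ k ∣ ≤ r`, which bounds `Y`.
    k : ℤ
    k = Y ℤ.- (a ℤ.+ + 2 ℤ.* b ℤ.+ + 4 ℤ.* c)
    r≡∣k∣p : r ≡ ∣ k ∣ * p
    r≡∣k∣p = trans (cong ∣_∣ (ℤ.i-j≡0⇒i≡j (+ r) (k ℤ.* + p) (trans
      (solve 6 (λ r p Y a b c → r :- (Y :- (a :+ con (+ 2) :* b :+ con (+ 4) :* c)) :* p :=
         r :- p :* Y :+ p :* a :+ con (+ 2) :* p :* b :+ con (+ 4) :* p :* c) refl (+ r) (+ p) Y a b c) eq)))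
      (ℤ.abs-* k (+ p))
    ∣k∣≤r : ∣ k ∣ ℕ.≤ r
    ∣k∣≤r = subst (∣ k ∣ ℕ.≤_) (sym r≡∣k∣p) (ℕ.m≤m*n ∣ k ∣ p {{ℕ.>-nonZero 0<p}})
    ∣Y∣<n : ∣ Y ∣ < n
    ∣Y∣<n = begin-strict
      ∣ Y ∣
        ≡⟨ cong ∣_∣ (solve 4 (λ Y a b c → Y := a :+ con (+ 2) :* b :+ con (+ 4) :* c :+ (Y :- (a :+ con (+ 2) :* b :+ con (+ 4) :* c))) refl Y a b c) ⟩
      ∣ a ℤ.+ + 2 ℤ.* b ℤ.+ + 4 ℤ.* c ℤ.+ k ∣          ≤⟨ ∣a+2b+4c+k∣≤ a b c k ⟩
      ∣ a ∣ ℕ.+ 2 * ∣ b ∣ ℕ.+ 4 * ∣ c ∣ ℕ.+ ∣ k ∣     ≤⟨ ℕ.+-monoʳ-≤ (∣ a ∣ ℕ.+ 2 * ∣ b ∣ ℕ.+ 4 * ∣ c ∣) ∣k∣≤r ⟩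
      ∣ a ∣ ℕ.+ 2 * ∣ b ∣ ℕ.+ 4 * ∣ c ∣ ℕ.+ r         <⟨ roots-bounded (∣ a ∣) (∣ b ∣) (∣ c ∣) bound′ ⟩
      n                                               ∎
      where
      open ℕ.≤-Reasoning
      bound′ : SqrtBound (∣ a ∣ * ∣ a ∣) (∣ b ∣ * ∣ b ∣) (∣ c ∣ * ∣ c ∣) r n
      bound′ = subst (λ x → SqrtBound x (∣ b ∣ * ∣ b ∣) (∣ c ∣ * ∣ c ∣) r n) x₁≡
        (subst₂ (λ x x′ → SqrtBound x₁ x x′ r n) x₂≡ x₃≡ bound)
    nonnegative : ∀ u → u ≡ v → 0ℤ ≤ℤ u
    nonnegative (+ m)    _    = ℤ.+≤+ ℕ.z≤n
    -- For `v = -(m + 1)`, `Y = y + n(m + 1)` is at least `n`, against `∣Y∣<n`.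
    nonnegative -[1+ m ] refl = contradiction ∣Y∣<n (ℕ.≤⇒≯ (begin
      n                       ≤⟨ ℕ.m≤m*n n (suc m) ⟩
      n * suc m               ≤⟨ ℕ.m≤n+m (n * suc m) y ⟩
      y ℕ.+ n * suc m         ≡⟨ cong ∣_∣ (trans (cong (λ z → + y ℤ.+ z) (ℤ.pos-* n (suc m)))
          (solve 3 (λ y n m → y :+ n :* m := y :- n :* :- m) refl (+ y) (+ n) (+ suc m))) ⟩
      ∣ Y ∣                   ∎))
      where open ℕ.≤-Reasoning

squares⇒K≡0 : ∀ a b c p q n m →
  ∃ λ (y : ℕ) → K (+ y) (+ (a * a)) (+ (b * b)) (+ (c * c)) (+ p) (+ (q * p)) (+ n) (+ m) ≡ 0ℤ
-- The witness makes `Y = y - nm` equal to `q + a + 2b + 4c`, hence `w = qp - pY = -(A + B + C)`,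
-- and the factor `w + A + B + C` of the norm vanishes.
squares⇒K≡0 a b c p q n m = n * m ℕ.+ (q ℕ.+ a ℕ.+ 2 * b ℕ.+ 4 * c) , trans
  (K≡norm (+ (n * m ℕ.+ (q ℕ.+ a ℕ.+ 2 * b ℕ.+ 4 * c)))
    (+ (a * a)) (+ (b * b)) (+ (c * c)) (+ p) (+ (q * p)) (+ n) (+ m)) (begin
  N (+ (q * p) ℤ.- + p ℤ.* Y) (+ p ℤ.* + p ℤ.* + (a * a)) (+ 2 ℤ.* + p ℤ.* (+ 2 ℤ.* + p) ℤ.* + (b * b))
      (+ 4 ℤ.* + p ℤ.* (+ 4 ℤ.* + p) ℤ.* + (c * c))
    ≡⟨ cong₂ (λ w (α , β , γ) → N w α β γ) w≡
         (cong₂ _,_ (scaled (+ p) a) (cong₂ _,_ (scaled (+ 2 ℤ.* + p) b) (scaled (+ 4 ℤ.* + p) c))) ⟩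
  N (- (A ℤ.+ B ℤ.+ C)) (A ℤ.* A) (B ℤ.* B) (C ℤ.* C)
    ≡⟨ solve 3 (λ A B C → P.N 3 (:- (A :+ B :+ C)) (A :* A) (B :* B) (C :* C) := con 0ℤ) refl A B C ⟩
  0ℤ ∎)
  where
  open ≡-Reasoning
  open Z using (N)
  A B C Y : ℤ
  A = + p ℤ.* + a
  B = + 2 ℤ.* + p ℤ.* + b
  C = + 4 ℤ.* + p ℤ.* + c
  Y = + (n * m ℕ.+ (q ℕ.+ a ℕ.+ 2 * b ℕ.+ 4 * c)) ℤ.- + n ℤ.* + m
  scaled : ∀ q a → q ℤ.* q ℤ.* + (a * a) ≡ q ℤ.* + a ℤ.* (q ℤ.* + a)
  scaled q a = trans (cong (λ z → q ℤ.* q ℤ.* z) (ℤ.pos-* a a))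
    (solve 2 (λ q a → q :* q :* (a :* a) := q :* a :* (q :* a)) refl q (+ a))
  Y≡ : Y ≡ + q ℤ.+ + a ℤ.+ + 2 ℤ.* + b ℤ.+ + 4 ℤ.* + c
  Y≡ = begin
    + (n * m) ℤ.+ (+ q ℤ.+ + a ℤ.+ + (2 * b) ℤ.+ + (4 * c)) ℤ.- + n ℤ.* + m
      ≡⟨ cong₂ (λ s t → s ℤ.+ t ℤ.- + n ℤ.* + m) (ℤ.pos-* n m)
           (cong₂ (λ s t → + q ℤ.+ + a ℤ.+ s ℤ.+ t) (ℤ.pos-* 2 b) (ℤ.pos-* 4 c)) ⟩
    + n ℤ.* + m ℤ.+ (+ q ℤ.+ + a ℤ.+ + 2 ℤ.* + b ℤ.+ + 4 ℤ.* + c) ℤ.- + n ℤ.* + m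
      ≡⟨ solve 2 (λ s t → s :+ t :- s := t) refl (+ n ℤ.* + m) (+ q ℤ.+ + a ℤ.+ + 2 ℤ.* + b ℤ.+ + 4 ℤ.* + c) ⟩
    + q ℤ.+ + a ℤ.+ + 2 ℤ.* + b ℤ.+ + 4 ℤ.* + c ∎
  w≡ : + (q * p) ℤ.- + p ℤ.* Y ≡ - (A ℤ.+ B ℤ.+ C)
  w≡ = trans (cong₂ (λ s t → s ℤ.- + p ℤ.* t) (ℤ.pos-* q p) Y≡)
    (solve 5 (λ p q a b c → q :* p :- p :* (q :+ a :+ con (+ 2) :* b :+ con (+ 4) :* c) :=
      :- (p :* a :+ con (+ 2) :* p :* b :+ con (+ 4) :* p :* c)) refl (+ p) (+ q) (+ a) (+ b) (+ c))

theorem5 : (x₁ x₂ x₃ p r n : ℕ) (v : ℤ) →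
    Odd x₁ → Odd x₂ → 0 < p → SqrtBound x₁ x₂ x₃ r n →
    (∃ λ (y : ℕ) → K (+ y) (+ x₁) (+ x₂) (+ x₃) (+ p) (+ r) (+ n) v ≡ 0ℤ)
    ⇔
    ((∃ λ (a : ℕ) → x₁ ≡ a * a) × (∃ λ (b : ℕ) → x₂ ≡ b * b) ×
    (∃ λ (c : ℕ) → x₃ ≡ c * c) × (p ∣ r) × (0ℤ ≤ℤ v))
theorem5 x₁ x₂ x₃ p r n v odd₁ odd₂ 0<p bound = mk⇔ (K≡0⇒squares x₁ x₂ x₃ p r n v odd₁ odd₂ 0<p bound)
  λ { ((a , refl) , (b , refl) , (c , refl) , divides q refl , ℤ.+≤+ {n = m} _) → squares⇒K≡0 a b c p q n m }
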